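{- For every positive integer $k$ there exists $n_0(k)$ such that the following holds for all integers $n \ge n_0(k)$. Let $L$ be a non-empty proper subset of $\{0,1,\ldots,k-1\}$. If $$\alpha(J(n,k,L)) \cdot \omega(J(n,k,L)) = \binom{n}{k},$$ then there exists an integer $t$ such that either $L$ or $\{0,\ldots,k-1\}\setminus L$ is equal to $\{0,1,\ldots,t-1\}$.
   Context: For integers $n,k$ and a set $L \subset \{0,1,\ldots,k-1\}$, the generalized Johnson graph $J(n,k,L)$ is the simple graph whose vertex set is $\binom{[n]}{k}$, the collection of all $k$-element subsets of $[n]=\{1,\ldots,n\}$, in which two distinct vertices $F_1,F_2$ are adjacent if and only if $|F_1\cap F_2|\in L$. For a graph $G$, $\omega(G)$ denotes the size of a largest clique in $G$, and $\alpha(G)$ denotes the size of a largest coclique (independent set) in $G$. -}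

module Defs where

open import Data.Nat using (ℕ; _≤_; _<_)
open import Data.Fin using (toℕ)
open import Data.Fin.Subset using (Subset; _∈_; _∩_; ∣_∣)
open import Data.Fin.Subset.Properties using (∩-comm)
open import Data.List using (List; length)
import Data.List.Membership.Propositional as List
open import Data.List.Relation.Unary.Unique.Propositional using (Unique)
open import Data.Product using (Σ; ∃-syntax; _×_; _,_; proj₁)
open import Function using (_∘_; _⇔_)
open import Relation.Binary.Definitions using (Symmetric; Irreflexive)
open import Relation.Binary.PropositionalEquality using (_≡_; _≢_; sym; subst; cong)
open import Relation.Nullary using (¬_)

record SimpleGraph : Set₁ where
  field
    Vertex     : Set
    Adj        : Vertex → Vertex → Set
    adj-sym    : Symmetric Adj
    adj-irrefl : Irreflexive _≡_ Adj

open SimpleGraph public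

-- Finite vertex sets are duplicate-free lists, so that `length` is cardinality.

record IsClique (G : SimpleGraph) (S : List (Vertex G)) : Set where
  field
    unique   : Unique S
    adjacent : ∀ {u v} → u List.∈ S → v List.∈ S → u ≢ v → Adj G u v

record IsCoclique (G : SimpleGraph) (S : List (Vertex G)) : Set where
  field
    unique      : Unique S
    nonadjacent : ∀ {u v} → u List.∈ S → v List.∈ S → ¬ Adj G u v

IsMaximumSize : {A : Set} → (List A → Set) → ℕ → Set
IsMaximumSize P m = (∃[ S ] P S × length S ≡ m) × (∀ S → P S → length S ≤ m)

-- ω(G) and α(G) are specified relationally: such an m is unique, and it exists
-- whenever G has finitely many vertices and decidable adjacency.

IsCliqueNumber : SimpleGraph → ℕ → Set
IsCliqueNumber G = IsMaximumSize (IsClique G)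

IsIndependenceNumber : SimpleGraph → ℕ → Set
IsIndependenceNumber G = IsMaximumSize (IsCoclique G)

-- A set L ⊆ {0,…,k-1} is a `Subset k`; this is membership of a natural number
-- in L, which is false for every j ≥ k.

infix 4 _∈ℕ_ _IsInitialSegment_

_∈ℕ_ : ∀ {k} → ℕ → Subset k → Set
j ∈ℕ L = ∃[ i ] i ∈ L × toℕ i ≡ j

-- L = {0,1,…,t-1} as sets of natural numbers (in particular t ≤ k).

_IsInitialSegment_ : ∀ {k} → Subset k → ℕ → Set
L IsInitialSegment t = ∀ j → j ∈ℕ L ⇔ j < t

KSubset : ℕ → ℕ → Set
KSubset n k = Σ (Subset n) λ F → ∣ F ∣ ≡ k

J : (n k : ℕ) → Subset k → SimpleGraph
J n k L = record
  { Vertex     = KSubset n k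
  ; Adj        = λ F₁ F₂ → F₁ ≢ F₂ × ∣ proj₁ F₁ ∩ proj₁ F₂ ∣ ∈ℕ L
  ; adj-sym    = λ {F₁} {F₂} (F₁≢F₂ , m∈L) →
      F₁≢F₂ ∘ sym , subst (_∈ℕ L) (cong ∣_∣ (∩-comm (proj₁ F₁) (proj₁ F₂))) m∈L
  ; adj-irrefl = λ F₁≡F₂ (F₁≢F₂ , _) → F₁≢F₂ F₁≡F₂
  }

{-# OPTIONS --safe #-}

-- Call 𝓕 an X-system if it consists of k-sets whose pairwise intersection sizes
-- lie in X.  Passing to the members through a point shows |𝓕| = O(n^|X|), where
-- X counts only below k: if 0 ∈ X there are n points to choose from, and otherwise
-- every member meets a fixed one, which leaves k points.
-- A clique is an L-system and a coclique is a system for the complement of L, so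
-- α ω = C(n,k) forces both bounds to be tight up to a constant.  Let X be the one of
-- the two sets that contains k-1.  If X is not upward closed, then l ∈ X and
-- l+1 ∉ X for some l < k-1, and the bound improves by a factor of n.  To see this,
-- reduce to l = 0 as before.  The members that meet no other member in k-1
-- points form an (X ∖ {k-1})-system.  Every other member F has a point z outside
-- some G with |F ∩ G| = k-1, and each H through z meets F ∪ G in more than a
-- points for some a ∈ X, a > 0; hence the element a of X costs no factor of n
-- when counting these H.

module Submission where

open import Data.Bool using (Bool; true; false; not; _∧_; if_then_else_)
open import Data.Bool.Properties using (∧-identityʳ; ∧-zeroʳ; not-involutive)
  renaming (_≟_ to _≟ᵇ_)
open import Data.Fin using (Fin; zero; suc)
open import Data.Fin.Properties using (any?; toℕ<n) renaming (_≟_ to _≟ᶠ_)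
open import Data.Fin.Subset using (Subset; Nonempty; _⊂_; ⊤; ⊥; ∁; _∈_; _∉_; _⊆_; _∩_; _∪_; ⁅_⁆; ∣_∣; inside; outside)
open import Data.Fin.Subset.Properties
  using (_∈?_; ∉⊥; ∣⊥∣≡0; ∪-identityʳ; x∈⁅x⁆; x∈⁅y⁆⇒x≡y; ⊆-antisym; p⊆q⇒∣p∣≤∣q∣; p⊂q⇒∣p∣<∣q∣
        ; x∈p∩q⁺; x∈p∩q⁻; p∩q⊆p; p∩q⊆q; ∣p∩q∣≤∣p∣; x∈p∪q⁺; x∈p∪q⁻)
open import Data.List using (List; []; _∷_; length; map; filter; allFin)
open import Data.List.Membership.Propositional using (find; lose) renaming (_∈_ to _∈ₗ_)
open import Data.List.Membership.Propositional.Properties using (∈-filter⁻; ∈-map⁺; ∈-map⁻; ∈-allFin)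
open import Data.List.Properties using (length-map; length-tabulate)
open import Data.List.Relation.Binary.Sublist.Propositional.Properties using (filter-⊆; length-mono-≤)
  renaming (filter⁺ to filter-mono-⊆)
open import Data.List.Relation.Unary.All using (_∷_)
open import Data.List.Relation.Unary.AllPairs using (_∷_)
open import Data.List.Relation.Unary.Any using (here; there) renaming (any? to anyₗ?)
open import Data.List.Relation.Unary.Unique.Propositional using (Unique)
import Data.List.Relation.Unary.Unique.Propositional.Properties as Unique
open import Data.Nat using (ℕ; zero; suc; _+_; _*_; _^_; _∸_; _!; _≤_; _<_; z≤n; s≤s; _≟_; _≤?_; _<?_; >-nonZero; ≢-nonZero)
open import Data.Nat.Combinatorics using (_C_; nCk≡n!/k![n-k]!; [n∸k]!k!∣n!)
open import Data.Nat.Divisibility using (_∣_)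
open import Data.Nat.DivMod using (_/_; m/n*n≡m)
open import Data.Nat.Properties
open import Data.Nat.Tactic.RingSolver using (solve-∀)
open import Data.Product using (∃-syntax; _×_; _,_; proj₁; proj₂)
open import Data.Sum using (_⊎_; inj₁; inj₂)
open import Data.Vec using ([]; _∷_) renaming (here to hereᵥ; there to thereᵥ)
open import Data.Vec.Properties using (≡-dec)
open import Function using (_∘_; mk⇔)
open import Level using (0ℓ)
open import Relation.Binary.PropositionalEquality using (_≡_; _≢_; refl; sym; trans; cong; cong₂; subst; module ≡-Reasoning)
open import Relation.Nullary using (Dec; yes; no; does; contradiction)
open import Relation.Nullary.Decidable using (¬?; _×-dec_; dec-true; dec-false)
open import Relation.Unary using (Pred; Decidable)
open import Defs

private variable
  n k : ℕ

-- Rearrangements of products and cardinalities of finite sets.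

*-swap : ∀ a b c → a * (b * c) ≡ b * (a * c)
*-swap = solve-∀

*-interchange : ∀ a b c d → a * b * (c * d) ≡ a * c * (b * d)
*-interchange = solve-∀

∣p∪⁅x⁆∣≡1+∣p∣ : ∀ (p : Subset n) {x} → x ∉ p → ∣ p ∪ ⁅ x ⁆ ∣ ≡ suc ∣ p ∣
∣p∪⁅x⁆∣≡1+∣p∣ (inside  ∷ p) {zero}  x∉p = contradiction hereᵥ x∉p
∣p∪⁅x⁆∣≡1+∣p∣ (outside ∷ p) {zero}  x∉p = cong (suc ∘ ∣_∣) (∪-identityʳ p)
∣p∪⁅x⁆∣≡1+∣p∣ (inside  ∷ p) {suc x} x∉p = cong suc (∣p∪⁅x⁆∣≡1+∣p∣ p (x∉p ∘ thereᵥ))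
∣p∪⁅x⁆∣≡1+∣p∣ (outside ∷ p) {suc x} x∉p = ∣p∪⁅x⁆∣≡1+∣p∣ p (x∉p ∘ thereᵥ)

∣p∪q∣≤∣p∣+∣q∣ : ∀ (p q : Subset n) → ∣ p ∪ q ∣ ≤ ∣ p ∣ + ∣ q ∣
∣p∪q∣≤∣p∣+∣q∣ []            []            = z≤n
∣p∪q∣≤∣p∣+∣q∣ (inside  ∷ p) (inside  ∷ q) = s≤s (≤-trans (∣p∪q∣≤∣p∣+∣q∣ p q) (+-monoʳ-≤ ∣ p ∣ (n≤1+n ∣ q ∣)))
∣p∪q∣≤∣p∣+∣q∣ (inside  ∷ p) (outside ∷ q) = s≤s (∣p∪q∣≤∣p∣+∣q∣ p q)
∣p∪q∣≤∣p∣+∣q∣ (outside ∷ p) (inside  ∷ q) = ≤-trans (s≤s (∣p∪q∣≤∣p∣+∣q∣ p q)) (≤-reflexive (sym (+-suc ∣ p ∣ ∣ q ∣)))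
∣p∪q∣≤∣p∣+∣q∣ (outside ∷ p) (outside ∷ q) = ∣p∪q∣≤∣p∣+∣q∣ p q

∣p∪⁅x⁆∣+d : ∀ (p : Subset n) {x d} → x ∉ p → ∣ p ∣ + suc d ≡ k → ∣ p ∪ ⁅ x ⁆ ∣ + d ≡ k
∣p∪⁅x⁆∣+d p {d = d} x∉p eq = trans (cong (_+ d) (∣p∪⁅x⁆∣≡1+∣p∣ p x∉p)) (trans (sym (+-suc ∣ p ∣ d)) eq)

∪⁅⁆-⊆ : ∀ {p q : Subset n} {x} → p ⊆ q → x ∈ q → p ∪ ⁅ x ⁆ ⊆ q
∪⁅⁆-⊆ {p = p} {q} {x} p⊆q x∈q y∈ with x∈p∪q⁻ p ⁅ x ⁆ y∈
... | inj₁ y∈p = p⊆q y∈p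
... | inj₂ y∈x = subst (_∈ q) (sym (x∈⁅y⁆⇒x≡y x y∈x)) x∈q

∣p∣<∣q∣⇒q⊈p : ∀ (p q : Subset n) → ∣ p ∣ < ∣ q ∣ → ∃[ x ] x ∈ q × x ∉ p
∣p∣<∣q∣⇒q⊈p p q p<q with any? (λ x → (x ∈? q) ×-dec ¬? (x ∈? p))
... | yes w = w
... | no ¬w = contradiction p<q (≤⇒≯ (p⊆q⇒∣p∣≤∣q∣ q⊆p))
  where
  q⊆p : q ⊆ p
  q⊆p {x} x∈q with x ∈? p
  ... | yes x∈p = x∈p
  ... | no x∉p  = contradiction (x , x∈q , x∉p) ¬w

p⊆q∧∣p∣≡∣q∣⇒p≡q : ∀ {p q : Subset n} → p ⊆ q → ∣ p ∣ ≡ ∣ q ∣ → p ≡ q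
p⊆q∧∣p∣≡∣q∣⇒p≡q {p = p} {q} p⊆q eq = ⊆-antisym p⊆q q⊆p
  where
  q⊆p : q ⊆ p
  q⊆p {x} x∈q with x ∈? p
  ... | yes x∈p = x∈p
  ... | no x∉p  = contradiction eq (<⇒≢ (p⊂q⇒∣p∣<∣q∣ (p⊆q , x , x∈q , x∉p)))

elements : Subset n → List (Fin n)
elements []            = []
elements (inside  ∷ p) = zero ∷ map suc (elements p)
elements (outside ∷ p) = map suc (elements p)

length-elements : ∀ (p : Subset n) → length (elements p) ≡ ∣ p ∣
length-elements []            = refl
length-elements (inside  ∷ p) = cong suc (trans (length-map suc (elements p)) (length-elements p))
length-elements (outside ∷ p) = trans (length-map suc (elements p)) (length-elements p)

∈-elements : ∀ {p : Subset n} {x} → x ∈ p → x ∈ₗ elements p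
∈-elements {p = inside  ∷ p} hereᵥ        = here refl
∈-elements {p = inside  ∷ p} (thereᵥ x∈p) = there (∈-map⁺ suc (∈-elements x∈p))
∈-elements {p = outside ∷ p} (thereᵥ x∈p) = ∈-map⁺ suc (∈-elements x∈p)

-- Covering a family by points.

length-filter-split : ∀ {A : Set} {P : Pred A 0ℓ} (P? : Decidable P) xs →
  length xs ≡ length (filter P? xs) + length (filter (¬? ∘ P?) xs)
length-filter-split P? [] = refl
length-filter-split P? (x ∷ xs) with P? x
... | yes _ = cong suc (length-filter-split P? xs)
... | no _  = trans (cong suc (length-filter-split P? xs)) (sym (+-suc _ _))

star : Fin n → List (Subset n) → List (Subset n)
star x = filter (x ∈?_)

-- The factor c lets a bound on c |𝓕| stand for a bound on |𝓕| / n, without division.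
length-cover : ∀ c b (xs : List (Fin n)) (𝓕 : List (Subset n)) →
  (∀ {F} → F ∈ₗ 𝓕 → ∃[ x ] x ∈ₗ xs × x ∈ F × c * length (star x 𝓕) ≤ b) →
  c * length 𝓕 ≤ length xs * b
length-cover c b [] [] h = ≤-reflexive (*-zeroʳ c)
length-cover c b [] (F ∷ 𝓕) h with h (here refl)
... | _ , () , _
length-cover {n} c b (x ∷ xs) 𝓕 h with c * length (star x 𝓕) ≤? b
... | no ≰b = ≤-trans (length-cover c b xs 𝓕 h′) (m≤n+m _ b)
  where
  h′ : ∀ {F} → F ∈ₗ 𝓕 → ∃[ y ] y ∈ₗ xs × y ∈ F × c * length (star y 𝓕) ≤ b
  h′ F∈ with h F∈
  ... | _ , here refl , _ , ≤b = contradiction ≤b ≰b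
  ... | y , there y∈ , y∈F , ≤b = y , y∈ , y∈F , ≤b
-- The star of `x` is paid for by one `b` and removed; the stars at the other points only shrink, so
-- their witnesses survive.
... | yes ≤b = begin
  c * length 𝓕                            ≡⟨ cong (c *_) (length-filter-split (x ∈?_) 𝓕) ⟩
  c * (length (star x 𝓕) + length rest)   ≡⟨ *-distribˡ-+ c _ (length rest) ⟩
  c * length (star x 𝓕) + c * length rest ≤⟨ +-mono-≤ ≤b (length-cover c b xs rest h′) ⟩
  b + length xs * b                       ∎
  where
  open ≤-Reasoning
  rest : List (Subset n)
  rest = filter (¬? ∘ (x ∈?_)) 𝓕
  h′ : ∀ {F} → F ∈ₗ rest → ∃[ y ] y ∈ₗ xs × y ∈ F × c * length (star y rest) ≤ b
  h′ F∈ with ∈-filter⁻ (¬? ∘ (x ∈?_)) {xs = 𝓕} F∈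
  ... | F∈𝓕 , x∉F with h F∈𝓕
  ... | _ , here refl , x∈F , _ = contradiction x∈F x∉F
  ... | y , there y∈ , y∈F , ≤b′ = y , y∈ , y∈F , ≤-trans (*-monoʳ-≤ c (length-mono-≤
          (filter-mono-⊆ (y ∈?_) (y ∈?_) (λ { refl y∈ → y∈ }) (filter-⊆ (¬? ∘ (x ∈?_)) 𝓕)))) ≤b′

-- Families with prescribed intersection sizes.

-- `Q` is a common core: the bounds go by induction on `k` minus its size, a star at a point outside
-- `Q` enlarging the core by one. `X` is a Boolean function on all sizes, so complements and
-- removals are pointwise.
record System (k : ℕ) (X : ℕ → Bool) (Q : Subset n) (𝓕 : List (Subset n)) : Set where
  field
    unique : Unique 𝓕
    size   : ∀ {F} → F ∈ₗ 𝓕 → ∣ F ∣ ≡ k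
    above  : ∀ {F} → F ∈ₗ 𝓕 → Q ⊆ F
    inter  : ∀ {F G} → F ∈ₗ 𝓕 → G ∈ₗ 𝓕 → F ≢ G → X ∣ F ∩ G ∣ ≡ true

open System

private variable
  X : ℕ → Bool
  Q : Subset n
  𝓕 : List (Subset n)

filter-system : ∀ {P : Pred (Subset n) 0ℓ} (P? : Decidable P) →
  System k X Q 𝓕 → System k X Q (filter P? 𝓕)
filter-system {𝓕 = 𝓕} P? S = record
  { unique = Unique.filter⁺ P? (unique S)
  ; size   = size S ∘ old
  ; above  = λ F∈ → above S (old F∈)
  ; inter  = λ F∈ G∈ → inter S (old F∈) (old G∈)
  }
  where
  old : ∀ {F} → F ∈ₗ filter P? 𝓕 → F ∈ₗ 𝓕
  old = proj₁ ∘ ∈-filter⁻ P? {xs = 𝓕}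

star-system : ∀ x → System {n} k X Q 𝓕 → System k X (Q ∪ ⁅ x ⁆) (star x 𝓕)
star-system {𝓕 = 𝓕} x S = record
  { unique = unique S′
  ; size   = size S′
  ; above  = λ F∈ → ∪⁅⁆-⊆ (above S′ F∈) (proj₂ (∈-filter⁻ (x ∈?_) {xs = 𝓕} F∈))
  ; inter  = inter S′
  }
  where S′ = filter-system (x ∈?_) S

system-length≤1 : System {n} k X Q 𝓕 → ∣ Q ∣ ≡ k → length 𝓕 ≤ 1
system-length≤1 {𝓕 = []} S eq = z≤n
system-length≤1 {𝓕 = _ ∷ []} S eq = ≤-refl
system-length≤1 {Q = Q} {𝓕 = F ∷ G ∷ 𝓕} S eq with unique S
... | (F≢G ∷ _) ∷ _ = contradiction (trans (sym (Q≡ (here refl))) (Q≡ (there (here refl)))) F≢G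
  where
  Q≡ : ∀ {H} → H ∈ₗ F ∷ G ∷ 𝓕 → Q ≡ H
  Q≡ H∈ = p⊆q∧∣p∣≡∣q∣⇒p≡q (above S H∈) (trans eq (sym (size S H∈)))

-- Powers of n attached to sets of sizes.

factor : ℕ → Bool → ℕ
factor n b = if b then n else 1

-- n to the power |X ∩ [q, q + d)|
weight : ℕ → (ℕ → Bool) → ℕ → ℕ → ℕ
weight n X q zero    = 1
weight n X q (suc d) = factor n (X q) * weight n X (suc q) d

-- Every size contributes the factor `n` to exactly one of the two weights. Hence the bounds for a
-- clique and a coclique multiply to a constant times `n ^ k`.
weight-complement : ∀ n {X Y} → (∀ j → Y j ≡ not (X j)) → ∀ q d →
  weight n X q d * weight n Y q d ≡ n ^ d
weight-complement n Y≡ q zero = refl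
weight-complement n {X} {Y} Y≡ q (suc d) = begin
  (factor n (X q) * w) * (factor n (Y q) * w′) ≡⟨ *-interchange (factor n (X q)) w (factor n (Y q)) w′ ⟩
  (factor n (X q) * factor n (Y q)) * (w * w′) ≡⟨ cong₂ _*_ (factors (X q) (Y q) (Y≡ q)) (weight-complement n Y≡ (suc q) d) ⟩
  n * n ^ d                                    ∎
  where
  open ≡-Reasoning
  w  = weight n X (suc q) d
  w′ = weight n Y (suc q) d
  factors : ∀ b c → c ≡ not b → factor n b * factor n c ≡ n
  factors true  _ refl = *-identityʳ n
  factors false _ refl = *-identityˡ n

remove : ℕ → (ℕ → Bool) → ℕ → Bool
remove m X j = X j ∧ not (does (j ≟ m))

remove-≢ : ∀ {m j} X → j ≢ m → remove m X j ≡ X j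
remove-≢ {m} {j} X j≢m rewrite dec-false (j ≟ m) j≢m = ∧-identityʳ (X j)

remove-≡ : ∀ m X → remove m X m ≡ false
remove-≡ m X rewrite dec-true (m ≟ m) refl = ∧-zeroʳ (X m)

-- By `q + d ≡ m` the size `m` is the last one in the range, so its removal costs exactly one factor
-- `n`.
weight-remove : ∀ n X {m} q d → q + d ≡ m → X m ≡ true →
  n * weight n (remove m X) q (suc d) ≡ weight n X q (suc d)
weight-remove n X {m} q zero q≡m Xm rewrite trans (sym (+-identityʳ q)) q≡m | remove-≡ m X | Xm = refl
weight-remove n X {m} q (suc d) q<m Xm = begin
  n * (factor n (remove m X q) * w) ≡⟨ cong (λ b → n * (factor n b * w)) (remove-≢ X (<⇒≢ (m+1+n≡o⇒m<o q<m))) ⟩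
  n * (factor n (X q) * w)          ≡⟨ *-swap n (factor n (X q)) w ⟩
  factor n (X q) * (n * w)          ≡⟨ cong (factor n (X q) *_) (weight-remove n X (suc q) d (trans (sym (+-suc q d)) q<m) Xm) ⟩
  weight n X q (suc (suc d))        ∎
  where
  open ≡-Reasoning
  w = weight n (remove m X) (suc q) (suc d)
  m+1+n≡o⇒m<o : q + suc d ≡ m → q < m
  m+1+n≡o⇒m<o eq = subst (q <_) eq (m<m+n q (s≤s z≤n))

-- The plain upper bound.

-- If the size of `Q` lies in `X`, all `n` points are candidates for a new core point. Otherwise
-- every member meets a fixed member `G` beyond `Q`, so the `k` points of `G` suffice.
length-descend : ∀ {K} c b → k ≤ K → System {n} k X Q 𝓕 → ∣ Q ∣ < k →
  (∀ x → x ∉ Q → c * length (star x 𝓕) ≤ b) →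
  c * length 𝓕 ≤ factor n (X ∣ Q ∣) * (K * b)
length-descend {k} {n} {X} {Q} {𝓕} {K} c b k≤K S Q<k h with X ∣ Q ∣ in XQ
... | true = begin
  c * length 𝓕            ≤⟨ length-cover c b (allFin n) 𝓕 covers ⟩
  length (allFin n) * b   ≡⟨ cong (_* b) (length-tabulate {n = n} _) ⟩
  n * b                   ≤⟨ *-monoʳ-≤ n (m≤n*m b K {{>-nonZero (≤-trans (s≤s z≤n) (≤-trans Q<k k≤K))}}) ⟩
  n * (K * b)             ∎
  where
  open ≤-Reasoning
  covers : ∀ {F} → F ∈ₗ 𝓕 → ∃[ x ] x ∈ₗ allFin n × x ∈ F × c * length (star x 𝓕) ≤ b
  covers {F} F∈ with ∣p∣<∣q∣⇒q⊈p Q F (subst (∣ Q ∣ <_) (sym (size S F∈)) Q<k)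
  ... | x , x∈F , x∉Q = x , ∈-allFin x , x∈F , h x x∉Q
length-descend {𝓕 = []} c b k≤K S Q<k h | false = ≤-trans (≤-reflexive (*-zeroʳ c)) z≤n
length-descend {k} {n} {X} {Q} {𝓕 = 𝓕@(G ∷ _)} {K} c b k≤K S Q<k h | false = begin
  c * length 𝓕            ≤⟨ length-cover c b (elements G) 𝓕 covers ⟩
  length (elements G) * b ≡⟨ cong (_* b) (trans (length-elements G) (size S (here refl))) ⟩
  k * b                   ≤⟨ *-monoˡ-≤ b k≤K ⟩
  K * b                   ≡⟨ *-identityˡ (K * b) ⟨
  1 * (K * b)             ∎
  where
  open ≤-Reasoning
  Q<∩ : ∀ {F} → F ∈ₗ 𝓕 → ∣ Q ∣ < ∣ F ∩ G ∣
  Q<∩ {F} F∈ = ≤∧≢⇒< (p⊆q⇒∣p∣≤∣q∣ (λ x∈Q → x∈p∩q⁺ (above S F∈ x∈Q , above S (here refl) x∈Q))) Q≢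
    where
    Q≢ : ∣ Q ∣ ≢ ∣ F ∩ G ∣
    Q≢ eq with ≡-dec _≟ᵇ_ F G
    -- For `F = G` the intersection has `k` elements, more than `Q`; for distinct members its size
    -- lies in `X`, unlike that of `Q`.
    ... | yes refl = contradiction (subst (_≤ ∣ Q ∣) (size S F∈) (≤-trans (p⊆q⇒∣p∣≤∣q∣ {p = G} (λ x∈ → x∈p∩q⁺ (x∈ , x∈))) (≤-reflexive (sym eq)))) (<⇒≱ Q<k)
    ... | no F≢G with trans (sym XQ) (trans (cong X eq) (inter S F∈ (here refl) F≢G))
    ...   | ()
  covers : ∀ {F} → F ∈ₗ 𝓕 → ∃[ x ] x ∈ₗ elements G × x ∈ F × c * length (star x 𝓕) ≤ b
  covers {F} F∈ with ∣p∣<∣q∣⇒q⊈p Q (F ∩ G) (Q<∩ F∈)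
  ... | x , x∈ , x∉Q with x∈p∩q⁻ F G x∈
  ...   | x∈F , x∈G = x , ∈-elements x∈G , x∈F , h x x∉Q

factor-power : ∀ f K c w → f * (K * (c * w)) ≡ K * c * (f * w)
factor-power = solve-∀

-- Each added core point costs `K`, and a factor `n` just when the current core size lies in `X`;
-- after `d` steps the core fills a whole member.
length-system : ∀ {K} d → k ≤ K → System {n} k X Q 𝓕 → ∣ Q ∣ + d ≡ k →
  length 𝓕 ≤ K ^ d * weight n X ∣ Q ∣ d
length-system zero k≤K S eq = system-length≤1 S (trans (sym (+-identityʳ _)) eq)
length-system {k} {n} {X} {Q} {𝓕} {K} (suc d) k≤K S eq = begin
  length 𝓕                                        ≡⟨ *-identityˡ (length 𝓕) ⟨
  1 * length 𝓕                                    ≤⟨ length-descend 1 (K ^ d * w) k≤K S Q<k star-bound ⟩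
  factor n (X ∣ Q ∣) * (K * (K ^ d * w))          ≡⟨ factor-power (factor n (X ∣ Q ∣)) K (K ^ d) w ⟩
  K ^ suc d * weight n X ∣ Q ∣ (suc d)            ∎
  where
  open ≤-Reasoning
  w = weight n X (suc ∣ Q ∣) d
  Q<k : ∣ Q ∣ < k
  Q<k = subst (∣ Q ∣ <_) eq (m<m+n ∣ Q ∣ (s≤s z≤n))
  star-bound : ∀ x → x ∉ Q → 1 * length (star x 𝓕) ≤ K ^ d * w
  star-bound x x∉Q = begin
    1 * length (star x 𝓕)                  ≡⟨ *-identityˡ _ ⟩
    length (star x 𝓕)                      ≤⟨ length-system d k≤K (star-system x S) (∣p∪⁅x⁆∣+d Q x∉Q eq) ⟩
    K ^ d * weight n X ∣ Q ∪ ⁅ x ⁆ ∣ d     ≡⟨ cong (λ q → K ^ d * weight n X q d) (∣p∪⁅x⁆∣≡1+∣p∣ Q x∉Q) ⟩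
    K ^ d * w                              ∎

-- Saving a factor of n at a gap.

-- An element a of X with ∣ Q ∣ ≤ a < ∣ H ∩ U ∣ for every member H costs no factor
-- of n, because the members can be sorted by their points in U when it is reached.
length-capped : ∀ {K} d (U : Subset n) → k ≤ K → ∣ U ∣ ≤ K → System {n} k X Q 𝓕 → ∣ Q ∣ + d ≡ k →
  (∀ {H} → H ∈ₗ 𝓕 → ∃[ a ] X a ≡ true × ∣ Q ∣ ≤ a × a < ∣ H ∩ U ∣) →
  n * length 𝓕 ≤ K ^ d * weight n X ∣ Q ∣ d
length-capped {n} {𝓕 = []} d U k≤K U≤K S eq h = ≤-trans (≤-reflexive (*-zeroʳ n)) z≤n
-- The core has `k` elements, so `a` is at least `k`, whereas it is below `∣ H ∩ U ∣`, which is at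
-- most `k`.
length-capped {n} {k} {X} {Q} {𝓕 = H ∷ _} zero U k≤K U≤K S eq h with h (here refl)
... | a , _ , Q≤a , a<H∩U = contradiction (≤-trans a<H∩U (≤-trans (∣p∩q∣≤∣p∣ H U) (≤-reflexive (size S (here refl)))))
        (≤⇒≯ (subst (_≤ a) (trans (sym (+-identityʳ _)) eq) Q≤a))
length-capped {n} {k} {X} {Q} {𝓕 = 𝓕@(_ ∷ _)} {K} (suc d) U k≤K U≤K S eq h = begin
  n * length 𝓕                           ≤⟨ length-cover n (K ^ d * (f * w)) (elements U) 𝓕 covers ⟩
  length (elements U) * (K ^ d * (f * w)) ≤⟨ *-monoˡ-≤ _ (≤-trans (≤-reflexive (length-elements U)) U≤K) ⟩
  K * (K ^ d * (f * w))                  ≡⟨ *-assoc K (K ^ d) (f * w) ⟨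
  K ^ suc d * (f * w)                    ∎
  where
  open ≤-Reasoning
  f = factor n (X ∣ Q ∣)
  w = weight n X (suc ∣ Q ∣) d
  star-bound : ∀ x → x ∉ Q → n * length (star x 𝓕) ≤ K ^ d * (f * w)
  star-bound x x∉Q with X ∣ Q ∣ in XQ
  -- This level would cost a factor `n`, but the points of `U` suffice; the saved factor is the `n`
  -- on the left, and the plain bound handles the star.
  ... | true = begin
    n * length (star x 𝓕)                        ≤⟨ *-monoʳ-≤ n (length-system d k≤K (star-system x S) (∣p∪⁅x⁆∣+d Q x∉Q eq)) ⟩
    n * (K ^ d * weight n X ∣ Q ∪ ⁅ x ⁆ ∣ d)     ≡⟨ cong (λ q → n * (K ^ d * weight n X q d)) (∣p∪⁅x⁆∣≡1+∣p∣ Q x∉Q) ⟩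
    n * (K ^ d * w)                              ≡⟨ *-swap n (K ^ d) w ⟩
    K ^ d * (n * w)                              ∎
  -- As `∣ Q ∣` is not in `X`, the element `a` is larger and remains available for the enlarged
  -- core.
  ... | false = begin
    n * length (star x 𝓕)                        ≤⟨ length-capped d U k≤K U≤K (star-system x S) (∣p∪⁅x⁆∣+d Q x∉Q eq) h′ ⟩
    K ^ d * weight n X ∣ Q ∪ ⁅ x ⁆ ∣ d           ≡⟨ cong (λ q → K ^ d * weight n X q d) (∣p∪⁅x⁆∣≡1+∣p∣ Q x∉Q) ⟩
    K ^ d * w                                    ≡⟨ cong (K ^ d *_) (*-identityˡ w) ⟨
    K ^ d * (1 * w)                              ∎
    where
    h′ : ∀ {H} → H ∈ₗ star x 𝓕 → ∃[ a ] X a ≡ true × ∣ Q ∪ ⁅ x ⁆ ∣ ≤ a × a < ∣ H ∩ U ∣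
    h′ H∈ with h (proj₁ (∈-filter⁻ (x ∈?_) {xs = 𝓕} H∈))
    ... | a , Xa , Q≤a , a< = a , Xa , subst (_≤ a) (sym (∣p∪⁅x⁆∣≡1+∣p∣ Q x∉Q)) (≤∧≢⇒< Q≤a Q≢a) , a<
      where
      Q≢a : ∣ Q ∣ ≢ a
      Q≢a eq″ with trans (sym XQ) (trans (cong X eq″) Xa)
      ... | ()
  covers : ∀ {H} → H ∈ₗ 𝓕 → ∃[ x ] x ∈ₗ elements U × x ∈ H × n * length (star x 𝓕) ≤ K ^ d * (f * w)
  covers {H} H∈ with h H∈
  ... | a , _ , Q≤a , a< with ∣p∣<∣q∣⇒q⊈p Q (H ∩ U) (≤-trans (s≤s Q≤a) a<)
  ...   | x , x∈ , x∉Q with x∈p∩q⁻ H U x∈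
  ...     | x∈H , x∈U = x , ∈-elements x∈U , x∈H , star-bound x x∉Q

-- The only point of `q` outside `r` is `z`, so `p ∩ q` lies in `p ∩ r` together with `z`.
∣p∩q∣≤1+∣p∩r∣ : ∀ (p q r : Subset n) {z} → ∣ q ∣ ≡ suc ∣ q ∩ r ∣ → z ∈ q → z ∉ r →
  ∣ p ∩ q ∣ ≤ suc ∣ p ∩ r ∣
∣p∩q∣≤1+∣p∩r∣ p q r {z} q≡ z∈q z∉r =
  ≤-trans (p⊆q⇒∣p∣≤∣q∣ covered) (≤-reflexive (∣p∪⁅x⁆∣≡1+∣p∣ (p ∩ r) (z∉r ∘ p∩q⊆q p r)))
  where
  only-z : ∀ {x} → x ∈ q → x ∉ r → x ≡ z
  only-z {x} x∈q x∉r with x ≟ᶠ z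
  ... | yes x≡z = x≡z
  ... | no x≢z = contradiction (p⊆q⇒∣p∣≤∣q∣ {p = (q ∩ r ∪ ⁅ z ⁆) ∪ ⁅ x ⁆} {q}
          (∪⁅⁆-⊆ (∪⁅⁆-⊆ (p∩q⊆p q r) z∈q) x∈q))
          (<⇒≱ (≤-reflexive (trans (cong suc (trans q≡ (sym (∣p∪⁅x⁆∣≡1+∣p∣ (q ∩ r) (z∉r ∘ p∩q⊆q q r)))))
            (sym (∣p∪⁅x⁆∣≡1+∣p∣ (q ∩ r ∪ ⁅ z ⁆) x∉)))))
    where
    x∉ : x ∉ q ∩ r ∪ ⁅ z ⁆
    x∉ x∈ with x∈p∪q⁻ (q ∩ r) ⁅ z ⁆ x∈
    ... | inj₁ x∈∩ = x∉r (p∩q⊆q q r x∈∩)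
    ... | inj₂ x∈z = x≢z (x∈⁅y⁆⇒x≡y z x∈z)
  covered : p ∩ q ⊆ p ∩ r ∪ ⁅ z ⁆
  covered {x} x∈ with x∈p∩q⁻ p q x∈ | x ∈? r
  ... | x∈p , x∈q | yes x∈r = x∈p∪q⁺ (inj₁ (x∈p∩q⁺ (x∈p , x∈r)))
  ... | x∈p , x∈q | no x∉r  = x∈p∪q⁺ (inj₂ (subst (_∈ ⁅ z ⁆) (sym (only-z x∈q x∉r)) (x∈⁅x⁆ z)))

-- The witness is `a = ∣ H ∩ G ∣`, exceeded in `F ∪ G` because of `z`. If it were only `∣ Q ∣`, then
-- for `H ≢ F` the set `H ∩ F` would have exactly `∣ Q ∣ + 1` elements: it contains `Q` and `z`, and
-- `F` has only `z` outside `G`. The gap excludes this size.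
near-pair-cap : ∀ {m F G H z} → System {n} (suc m) X Q 𝓕 → X (suc ∣ Q ∣) ≡ false → ∣ Q ∣ < m →
  F ∈ₗ 𝓕 → G ∈ₗ 𝓕 → H ∈ₗ 𝓕 → ∣ F ∩ G ∣ ≡ m → z ∈ F → z ∉ G → z ∈ H →
  ∃[ a ] X a ≡ true × suc ∣ Q ∣ ≤ a × a < ∣ H ∩ (F ∪ G) ∣
near-pair-cap {X = X} {Q = Q} {m = m} {F} {G} {H} {z} S X1+Q Q<m F∈ G∈ H∈ FG z∈F z∉G z∈H =
  ∣ H ∩ G ∣ , inter S H∈ G∈ H≢G , ≤∧≢⇒< Q≤HG Q≢HG , p⊂q⇒∣p∣<∣q∣
    ( (λ x∈ → let x∈H , x∈G = x∈p∩q⁻ H G x∈ in x∈p∩q⁺ (x∈H , x∈p∪q⁺ (inj₂ x∈G)))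
    , z , x∈p∩q⁺ (z∈H , x∈p∪q⁺ (inj₁ z∈F)) , z∉G ∘ p∩q⊆q H G )
  where
  H≢G : H ≢ G
  H≢G refl = z∉G z∈H
  Q≤HG : ∣ Q ∣ ≤ ∣ H ∩ G ∣
  Q≤HG = p⊆q⇒∣p∣≤∣q∣ (λ x∈ → x∈p∩q⁺ (above S H∈ x∈ , above S G∈ x∈))
  Q<HF : suc ∣ Q ∣ ≤ ∣ H ∩ F ∣
  Q<HF = ≤-trans (≤-reflexive (sym (∣p∪⁅x⁆∣≡1+∣p∣ Q (z∉G ∘ above S G∈))))
    (p⊆q⇒∣p∣≤∣q∣ (∪⁅⁆-⊆ (λ x∈ → x∈p∩q⁺ (above S H∈ x∈ , above S F∈ x∈)) (x∈p∩q⁺ (z∈H , z∈F))))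
  Q≢HG : ∣ Q ∣ ≢ ∣ H ∩ G ∣
  Q≢HG eq with ≡-dec _≟ᵇ_ H F
  -- For `H = F` the intersection with `G` has size `m`, larger than `∣ Q ∣`.
  ... | yes refl = <⇒≢ Q<m (trans eq FG)
  ... | no H≢F with trans (sym X1+Q) (trans (cong X 1+Q≡HF) (inter S H∈ F∈ H≢F))
    where
    1+Q≡HF : suc ∣ Q ∣ ≡ ∣ H ∩ F ∣
    1+Q≡HF = ≤-antisym Q<HF (≤-trans (∣p∩q∣≤1+∣p∩r∣ H F G (trans (size S F∈) (cong suc (sym FG))) z∈F z∉G)
      (s≤s (≤-reflexive (sym eq))))
  ...   | ()

-- The factor 2 adds two parts of the family: members that meet some member in `m` points save `n`
-- by the cap `F ∪ G`, the others by losing the size `m` from `X`.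
length-gap-base : ∀ {K m} d → suc m + suc m ≤ K → System {n} (suc m) X Q 𝓕 → ∣ Q ∣ + d ≡ m →
  X ∣ Q ∣ ≡ true → X (suc ∣ Q ∣) ≡ false → ∣ Q ∣ < m → X m ≡ true →
  n * length 𝓕 ≤ 2 * K ^ suc d * weight n X ∣ Q ∣ (suc d)
length-gap-base {n} {X} {Q} {𝓕} {K} {m} d 2k≤K S eq XQ X1+Q Q<m Xm = begin
  n * length 𝓕                               ≡⟨ cong (n *_) (length-filter-split near? 𝓕) ⟩
  n * (length near + length far)             ≡⟨ *-distribˡ-+ n (length near) (length far) ⟩
  n * length near + n * length far           ≤⟨ +-mono-≤ near-bound far-bound ⟩
  K ^ suc d * W + K ^ suc d * W              ≡⟨ double (K ^ suc d) W ⟩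
  2 * K ^ suc d * W                          ∎
  where
  open ≤-Reasoning
  k≤K : suc m ≤ K
  k≤K = ≤-trans (m≤m+n (suc m) (suc m)) 2k≤K
  W = weight n X ∣ Q ∣ (suc d)
  w = weight n X (suc ∣ Q ∣) d
  double : ∀ a b → a * b + a * b ≡ 2 * a * b
  double = solve-∀
  near? : ∀ F → Dec _
  -- Members have `m + 1` elements, so such a `G` differs from `F`.
  near? F = anyₗ? (λ G → ∣ F ∩ G ∣ ≟ m) 𝓕
  near = filter near? 𝓕
  far  = filter (¬? ∘ near?) 𝓕
  eq′ : ∣ Q ∣ + suc d ≡ suc m
  eq′ = trans (+-suc ∣ Q ∣ d) (cong suc eq)

  far-system : System (suc m) (remove m X) Q far
  far-system = record
    { unique = unique S′
    ; size   = size S′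
    ; above  = above S′
    ; inter  = λ F∈ G∈ F≢G → trans (remove-≢ X (far-≢ F∈ G∈)) (inter S′ F∈ G∈ F≢G)
    }
    where
    S′ = filter-system (¬? ∘ near?) S
    far-≢ : ∀ {F G} → F ∈ₗ far → G ∈ₗ far → ∣ F ∩ G ∣ ≢ m
    far-≢ F∈ G∈ eq″ = proj₂ (∈-filter⁻ (¬? ∘ near?) {xs = 𝓕} F∈)
      (lose (proj₁ (∈-filter⁻ (¬? ∘ near?) {xs = 𝓕} G∈)) eq″)

  far-bound : n * length far ≤ K ^ suc d * W
  far-bound = begin
    n * length far                                         ≤⟨ *-monoʳ-≤ n (length-system (suc d) k≤K far-system eq′) ⟩
    n * (K ^ suc d * weight n (remove m X) ∣ Q ∣ (suc d))  ≡⟨ *-swap n (K ^ suc d) _ ⟩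
    K ^ suc d * (n * weight n (remove m X) ∣ Q ∣ (suc d))  ≡⟨ cong (K ^ suc d *_) (weight-remove n X ∣ Q ∣ d eq Xm) ⟩
    K ^ suc d * W                                          ∎

  covers : ∀ {F} → F ∈ₗ near → ∃[ z ] z ∈ₗ allFin n × z ∈ F × n * length (star z near) ≤ K ^ d * w
  covers {F} F∈near with ∈-filter⁻ near? {xs = 𝓕} F∈near
  ... | F∈ , nearF with find nearF
  ...   | G , G∈ , FG with ∣p∣<∣q∣⇒q⊈p (F ∩ G) F (≤-reflexive (trans (cong suc FG) (sym (size S F∈))))
  ...     | z , z∈F , z∉F∩G = z , ∈-allFin z , z∈F , (begin
    n * length (star z near)              ≤⟨ length-capped d (F ∪ G) k≤K FG≤K (star-system z (filter-system near? S)) eq″ cap ⟩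
    K ^ d * weight n X ∣ Q ∪ ⁅ z ⁆ ∣ d    ≡⟨ cong (λ q → K ^ d * weight n X q d) Qz ⟩
    K ^ d * w                             ∎)
    where
    z∉G : z ∉ G
    z∉G z∈G = z∉F∩G (x∈p∩q⁺ (z∈F , z∈G))
    Qz : ∣ Q ∪ ⁅ z ⁆ ∣ ≡ suc ∣ Q ∣
    Qz = ∣p∪⁅x⁆∣≡1+∣p∣ Q (z∉G ∘ above S G∈)
    eq″ : ∣ Q ∪ ⁅ z ⁆ ∣ + d ≡ suc m
    eq″ = trans (cong (_+ d) Qz) (cong suc eq)
    FG≤K : ∣ F ∪ G ∣ ≤ K
    -- The cap is a union of two members, whence `K` is at least twice the member size.
    FG≤K = ≤-trans (∣p∪q∣≤∣p∣+∣q∣ F G) (≤-trans (≤-reflexive (cong₂ _+_ (size S F∈) (size S G∈))) 2k≤K)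
    cap : ∀ {H} → H ∈ₗ star z near → ∃[ a ] X a ≡ true × ∣ Q ∪ ⁅ z ⁆ ∣ ≤ a × a < ∣ H ∩ (F ∪ G) ∣
    cap H∈ with ∈-filter⁻ (z ∈?_) {xs = near} H∈
    ... | H∈near , z∈H with near-pair-cap S X1+Q Q<m F∈ G∈ (proj₁ (∈-filter⁻ near? {xs = 𝓕} H∈near)) FG z∈F z∉G z∈H
    ...   | a , Xa , Q<a , a< = a , Xa , subst (_≤ a) (sym Qz) Q<a , a<

  near-bound : n * length near ≤ K ^ suc d * W
  near-bound = begin
    n * length near                          ≤⟨ length-cover n (K ^ d * w) (allFin n) near covers ⟩
    length (allFin n) * (K ^ d * w)          ≡⟨ cong (_* (K ^ d * w)) (length-tabulate {n = n} _) ⟩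
    n * (K ^ d * w)                          ≡⟨ *-swap n (K ^ d) w ⟩
    -- Choosing `z` among `n` points is paid for by the factor that `∣ Q ∣`, being in `X`,
    -- contributes to `W`.
    K ^ d * (n * w)                          ≡⟨ cong (λ b → K ^ d * (factor n b * w)) XQ ⟨
    K ^ d * W                                ≤⟨ *-monoˡ-≤ W (m≤n*m (K ^ d) K {{>-nonZero (≤-trans (s≤s z≤n) k≤K)}}) ⟩
    K ^ suc d * W                            ∎

-- The core grows by `length-descend`, with `c = n` carrying the saved factor, until its size is
-- `l`, where the gap argument applies.
length-gap : ∀ {K m l} d → suc m + suc m ≤ K → System {n} (suc m) X Q 𝓕 → ∣ Q ∣ + d ≡ suc m →
  ∣ Q ∣ ≤ l → X l ≡ true → X (suc l) ≡ false → l < m → X m ≡ true →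
  n * length 𝓕 ≤ 2 * K ^ d * weight n X ∣ Q ∣ d
length-gap {m = m} {l} zero 2k≤K S eq Q≤l Xl X1+l l<m Xm =
  contradiction (subst (_≤ l) (trans (sym (+-identityʳ _)) eq) Q≤l) (<⇒≱ (m≤n⇒m≤1+n l<m))
length-gap {n} {X} {Q} {𝓕} {K} {m} {l} (suc d) 2k≤K S eq Q≤l Xl X1+l l<m Xm with ∣ Q ∣ ≟ l
... | yes refl = length-gap-base d 2k≤K S (suc-injective (trans (sym (+-suc ∣ Q ∣ d)) eq)) Xl X1+l l<m Xm
... | no Q≢l = begin
  n * length 𝓕                                ≤⟨ length-descend n (2 * K ^ d * w) k≤K S Q<k star-bound ⟩
  factor n (X ∣ Q ∣) * (K * (2 * K ^ d * w))  ≡⟨ factor-power (factor n (X ∣ Q ∣)) K (2 * K ^ d) w ⟩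
  K * (2 * K ^ d) * (factor n (X ∣ Q ∣) * w)  ≡⟨ cong (_* (factor n (X ∣ Q ∣) * w)) (*-swap K 2 (K ^ d)) ⟩
  2 * K ^ suc d * weight n X ∣ Q ∣ (suc d)    ∎
  where
  open ≤-Reasoning
  w = weight n X (suc ∣ Q ∣) d
  k≤K : suc m ≤ K
  k≤K = ≤-trans (m≤m+n (suc m) (suc m)) 2k≤K
  Q<k : ∣ Q ∣ < suc m
  Q<k = subst (∣ Q ∣ <_) eq (m<m+n ∣ Q ∣ (s≤s z≤n))
  star-bound : ∀ x → x ∉ Q → n * length (star x 𝓕) ≤ 2 * K ^ d * w
  star-bound x x∉Q = begin
    n * length (star x 𝓕)                  ≤⟨ length-gap d 2k≤K (star-system x S) (∣p∪⁅x⁆∣+d Q x∉Q eq) Qx≤l Xl X1+l l<m Xm ⟩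
    2 * K ^ d * weight n X ∣ Q ∪ ⁅ x ⁆ ∣ d ≡⟨ cong (λ q → 2 * K ^ d * weight n X q d) Qx ⟩
    2 * K ^ d * w                          ∎
    where
    Qx = ∣p∪⁅x⁆∣≡1+∣p∣ Q x∉Q
    Qx≤l : ∣ Q ∪ ⁅ x ⁆ ∣ ≤ l
    Qx≤l = subst (_≤ l) (sym Qx) (≤∧≢⇒< Q≤l Q≢l)

-- Binomial estimates and the threshold.

-- Passing from `m !` to `(m + k) !` multiplies by `k` factors, each at least `m`.
m^k*m!≤[m+k]! : ∀ m k → m ^ k * m ! ≤ (m + k) !
m^k*m!≤[m+k]! m zero = ≤-reflexive (trans (*-identityˡ (m !)) (cong _! (sym (+-identityʳ m))))
m^k*m!≤[m+k]! m (suc k) = begin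
  m * m ^ k * m !           ≡⟨ *-assoc m (m ^ k) (m !) ⟩
  m * (m ^ k * m !)         ≤⟨ *-mono-≤ (m≤n⇒m≤1+n (m≤m+n m k)) (m^k*m!≤[m+k]! m k) ⟩
  suc (m + k) * (m + k) !   ≡⟨ cong _! (+-suc m k) ⟨
  (m + suc k) !             ∎
  where open ≤-Reasoning

m^k≤[m+k]Ck*k! : ∀ m k → m ^ k ≤ ((m + k) C k) * k !
m^k≤[m+k]Ck*k! m k = *-cancelʳ-≤ (m ^ k) (((m + k) C k) * k !) (m !) {{m !≢0}} (begin
  m ^ k * m !                    ≤⟨ m^k*m!≤[m+k]! m k ⟩
  N !                            ≡⟨ m/n*n≡m {{k !* (N ∸ k) !≢0}} (subst (_∣ N !) (*-comm ((N ∸ k) !) (k !)) ([n∸k]!k!∣n! k≤n)) ⟨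
  (N ! / (k ! * (N ∸ k) !)) {{k !* (N ∸ k) !≢0}} * (k ! * (N ∸ k) !) ≡⟨ cong (_* (k ! * (N ∸ k) !)) (nCk≡n!/k![n-k]! k≤n) ⟨
  (N C k) * (k ! * (N ∸ k) !)      ≡⟨ *-assoc (N C k) (k !) _ ⟨
  (N C k) * k ! * (N ∸ k) !        ≡⟨ cong (λ j → (N C k) * k ! * j !) (m+n∸n≡m m k) ⟩
  (N C k) * k ! * m !              ∎)
  where
  open ≤-Reasoning
  N = m + k
  k≤n : k ≤ N
  k≤n = m≤n+m k m

-- With `K = k + k`, the factors are `2 * K ^ k` from the gap bound, `K ^ k` from the plain bound
-- and `2 ^ k * k !` from comparing `n ^ k` with `n C k`.
threshold-constant : ℕ → ℕ
threshold-constant k = 2 * (k + k) ^ k * (k + k) ^ k * (2 ^ k * k !)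

-- The summand `k + k` serves the comparison of `n ^ k` with `n C k`.
threshold : ℕ → ℕ
threshold k = suc (threshold-constant k) + (k + k)

^-distribʳ-* : ∀ k m n → (m * n) ^ k ≡ m ^ k * n ^ k
^-distribʳ-* zero    m n = refl
^-distribʳ-* (suc k) m n = trans (cong (m * n *_) (^-distribʳ-* k m n)) (*-interchange m n (m ^ k) (n ^ k))

-- The hypothesis gives `n ≤ 2 * (n ∸ k)`, and `k !` times the binomial coefficient is at least
-- `(n ∸ k) ^ k`.
n^k≤2^k*k!*nCk : ∀ {n k} → k + k ≤ n → n ^ k ≤ (2 ^ k * k !) * (n C k)
n^k≤2^k*k!*nCk {n} {k} 2k≤n = begin
  n ^ k                     ≤⟨ ^-monoˡ-≤ k n≤2m ⟩
  (2 * m) ^ k               ≡⟨ ^-distribʳ-* k 2 m ⟩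
  2 ^ k * m ^ k             ≤⟨ *-monoʳ-≤ (2 ^ k) (m^k≤[m+k]Ck*k! m k) ⟩
  2 ^ k * (((m + k) C k) * k !) ≡⟨ cong (λ j → 2 ^ k * ((j C k) * k !)) (m∸n+n≡m k≤n) ⟩
  2 ^ k * ((n C k) * k !)     ≡⟨ rearrange (2 ^ k) (n C k) (k !) ⟩
  (2 ^ k * k !) * (n C k)   ∎
  where
  open ≤-Reasoning
  m = n ∸ k
  k≤n : k ≤ n
  k≤n = ≤-trans (m≤m+n k k) 2k≤n
  k≤m : k ≤ m
  k≤m = m+n≤o⇒m≤o∸n k 2k≤n
  n≤2m : n ≤ 2 * m
  n≤2m = begin
    n             ≡⟨ m∸n+n≡m k≤n ⟨
    m + k         ≤⟨ +-monoʳ-≤ m k≤m ⟩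
    m + m         ≡⟨ cong (m +_) (+-identityʳ m) ⟨
    2 * m         ∎
  rearrange : ∀ a b c → a * (b * c) ≡ a * c * b
  rearrange = solve-∀

-- Contradiction from a gap.

-- At a gap, `n` times the product of the two lengths is at most a constant times `n ^ k`, hence a
-- constant times `n C k`. Cancelling the binomial coefficient bounds `n` by `threshold-constant`.
no-gap : ∀ {m X Y} {𝓐 𝓑 : List (Subset n)} → threshold (suc m) ≤ n → (∀ j → Y j ≡ not (X j)) →
  System (suc m) X ⊥ 𝓐 → System (suc m) Y ⊥ 𝓑 → length 𝓐 * length 𝓑 ≡ n C suc m →
  X m ≡ true → ∀ l → l < m → X l ≡ true → X (suc l) ≡ true
no-gap {n} {m} {X} {Y} {𝓐} {𝓑} n₀≤n Y≡ SA SB AB≡ Xm l l<m Xl with X (suc l) in X1+l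
... | true = refl
... | false = contradiction n≤c (<⇒≱ (≤-trans (m≤m+n (suc (threshold-constant (suc m))) _) n₀≤n))
  where
  open ≤-Reasoning
  κ = suc m
  K = κ + κ
  B = n C κ
  wX = weight n X 0 κ
  wY = weight n Y 0 κ
  ∣⊥∣≡0′ : ∣ ⊥ {n} ∣ ≡ 0
  ∣⊥∣≡0′ = ∣⊥∣≡0 n
  ⊥+k≡k : ∣ ⊥ {n} ∣ + κ ≡ κ
  ⊥+k≡k = cong (_+ κ) ∣⊥∣≡0′
  2k≤n : κ + κ ≤ n
  2k≤n = ≤-trans (m≤n+m (κ + κ) (suc (threshold-constant κ))) n₀≤n
  A-bound : n * length 𝓐 ≤ 2 * K ^ κ * wX
  A-bound = subst (λ q → n * length 𝓐 ≤ 2 * K ^ κ * weight n X q κ) ∣⊥∣≡0′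
    (length-gap κ ≤-refl SA ⊥+k≡k (≤-trans (≤-reflexive ∣⊥∣≡0′) z≤n) Xl X1+l l<m Xm)
  B-bound : length 𝓑 ≤ K ^ κ * wY
  B-bound = subst (λ q → length 𝓑 ≤ K ^ κ * weight n Y q κ) ∣⊥∣≡0′
    (length-system κ (m≤m+n κ κ) SB ⊥+k≡k)
  nB≤cB : n * B ≤ threshold-constant κ * B
  nB≤cB = begin
    n * B                          ≡⟨ cong (n *_) AB≡ ⟨
    n * (length 𝓐 * length 𝓑)      ≡⟨ *-assoc n (length 𝓐) (length 𝓑) ⟨
    n * length 𝓐 * length 𝓑        ≤⟨ *-mono-≤ A-bound B-bound ⟩
    2 * K ^ κ * wX * (K ^ κ * wY)  ≡⟨ *-interchange (2 * K ^ κ) wX (K ^ κ) wY ⟩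
    2 * K ^ κ * K ^ κ * (wX * wY)  ≡⟨ cong (2 * K ^ κ * K ^ κ *_) (weight-complement n Y≡ 0 κ) ⟩
    2 * K ^ κ * K ^ κ * n ^ κ      ≤⟨ *-monoʳ-≤ (2 * K ^ κ * K ^ κ) (n^k≤2^k*k!*nCk 2k≤n) ⟩
    2 * K ^ κ * K ^ κ * ((2 ^ κ * κ !) * B)  ≡⟨ *-assoc (2 * K ^ κ * K ^ κ) _ B ⟨
    threshold-constant κ * B       ∎
  0<n : 0 < n
  0<n = ≤-trans (s≤s z≤n) n₀≤n
  B≢0 : B ≢ 0
  B≢0 B≡0 = contradiction
    (≤-trans (m^n>0 n {{>-nonZero 0<n}} κ) (≤-trans (n^k≤2^k*k!*nCk 2k≤n) (≤-reflexive (trans (cong ((2 ^ κ * κ !) *_) B≡0) (*-zeroʳ (2 ^ κ * κ !))))))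
    λ ()
  n≤c : n ≤ threshold-constant κ
  n≤c = *-cancelʳ-≤ n (threshold-constant κ) B {{≢-nonZero B≢0}} nB≤cB

-- Upward closed sets and initial segments.

-- Here `t` is the least element of `X` below `k`, or `k` if there is none; the induction shifts `X`
-- down by one.
upward-closed⇒final : ∀ k (X : ℕ → Bool) → (∀ l → suc l < k → X l ≡ true → X (suc l) ≡ true) →
  ∃[ t ] t ≤ k × (∀ j → j < k → (j < t → X j ≡ false) × (t ≤ j → X j ≡ true))
upward-closed⇒final zero X up = 0 , z≤n , λ _ ()
upward-closed⇒final (suc k) X up with X 0 in X0
... | true = 0 , z≤n , λ j j<k → (λ ()) , λ _ → all-true j j<k
  where
  all-true : ∀ j → j < suc k → X j ≡ true
  all-true zero    _   = X0
  all-true (suc j) j<k = up j j<k (all-true j (<-trans (n<1+n j) j<k))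
... | false with upward-closed⇒final k (X ∘ suc) (λ l l<k → up (suc l) (s≤s l<k))
...   | t , t≤k , h = suc t , s≤s t≤k , h′
  where
  h′ : ∀ j → j < suc k → (j < suc t → X j ≡ false) × (suc t ≤ j → X j ≡ true)
  h′ zero    _         = (λ _ → X0) , λ ()
  h′ (suc j) (s≤s j<k) = (λ { (s≤s j<t) → proj₁ (h j j<k) j<t }) , λ { (s≤s t≤j) → proj₂ (h j j<k) t≤j }

indicator : Subset k → ℕ → Bool
indicator []      _       = false
indicator (b ∷ L) zero    = b
indicator (b ∷ L) (suc j) = indicator L j

∈ℕ⇒indicator : ∀ {j} (L : Subset k) → j ∈ℕ L → indicator L j ≡ true
∈ℕ⇒indicator (_ ∷ L) (_ , hereᵥ      , refl) = refl
∈ℕ⇒indicator (_ ∷ L) (_ , thereᵥ i∈L , refl) = ∈ℕ⇒indicator L (_ , i∈L , refl)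

indicator⇒∈ℕ : ∀ {j} (L : Subset k) → indicator L j ≡ true → j ∈ℕ L
indicator⇒∈ℕ {j = zero}  (true ∷ L) eq = zero , hereᵥ , refl
indicator⇒∈ℕ {j = suc j} (b ∷ L)    eq with indicator⇒∈ℕ L eq
... | i , i∈L , refl = suc i , thereᵥ i∈L , refl

-- The bound `j < k` matters: from `k` on both indicators are `false`.
indicator-∁ : ∀ (L : Subset k) j → j < k → indicator (∁ L) j ≡ not (indicator L j)
indicator-∁ (b ∷ L) zero    _         = refl
indicator-∁ (b ∷ L) (suc j) (s≤s j<k) = indicator-∁ L j j<k

∈ℕ⇒< : ∀ {j} {L : Subset k} → j ∈ℕ L → j < k
∈ℕ⇒< (i , _ , refl) = toℕ<n i

complement-initial : ∀ (L : Subset k) (X : ℕ → Bool) → (∀ j → j < k → indicator L j ≡ not (X j)) →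
  (∀ l → suc l < k → X l ≡ true → X (suc l) ≡ true) → ∃[ t ] L IsInitialSegment t
complement-initial {k} L X L≡ up with upward-closed⇒final k X up
... | t , t≤k , h = t , λ j → mk⇔ to from
  where
  to : ∀ {j} → j ∈ℕ L → j < t
  to {j} j∈L with j <? t
  ... | yes j<t = j<t
  ... | no j≮t with trans (sym (∈ℕ⇒indicator L j∈L))
                      (trans (L≡ j (∈ℕ⇒< j∈L)) (cong not (proj₂ (h j (∈ℕ⇒< j∈L)) (≮⇒≥ j≮t))))
  ...   | ()
  from : ∀ {j} → j < t → j ∈ℕ L
  from {j} j<t = indicator⇒∈ℕ L (trans (L≡ j j<k) (cong not (proj₁ (h j j<k) j<t)))
    where
    j<k : j < k
    j<k = <-≤-trans j<t t≤k

-- Cliques and cocliques as systems.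

-- Equality proofs in `ℕ` are unique, so passing from vertices to their sets creates no duplicates.
proj₁-injective : ∀ {F G : KSubset n k} → proj₁ F ≡ proj₁ G → F ≡ G
proj₁-injective {F = F , p} {_ , q} refl = cong (F ,_) (≡-irrelevant p q)

vertices-system : ∀ {S : List (KSubset n k)} → Unique S →
  (∀ {u v} → u ∈ₗ S → v ∈ₗ S → u ≢ v → X ∣ proj₁ u ∩ proj₁ v ∣ ≡ true) →
  System k X ⊥ (map proj₁ S)
vertices-system {n} {k} {X} {S} S! h = record
  { unique = Unique.map⁺ proj₁-injective S!
  ; size   = size′
  ; above  = λ _ x∈⊥ → contradiction x∈⊥ ∉⊥
  ; inter  = inter′
  }
  where
  size′ : ∀ {F} → F ∈ₗ map proj₁ S → ∣ F ∣ ≡ k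
  size′ F∈ with ∈-map⁻ proj₁ F∈
  ... | (_ , F≡k) , _ , refl = F≡k
  inter′ : ∀ {F G} → F ∈ₗ map proj₁ S → G ∈ₗ map proj₁ S → F ≢ G → X ∣ F ∩ G ∣ ≡ true
  inter′ F∈ G∈ F≢G with ∈-map⁻ proj₁ F∈ | ∈-map⁻ proj₁ G∈
  ... | u , u∈ , refl | v , v∈ , refl = h u∈ v∈ (F≢G ∘ cong proj₁)

clique-system : ∀ {L : Subset k} {S} → IsClique (J n k L) S → System k (indicator L) ⊥ (map proj₁ S)
clique-system {L = L} cl = vertices-system (IsClique.unique cl)
  λ u∈ v∈ u≢v → ∈ℕ⇒indicator L (proj₂ (IsClique.adjacent cl u∈ v∈ u≢v))

coclique-system : ∀ {L : Subset k} {S} → IsCoclique (J n k L) S → System k (not ∘ indicator L) ⊥ (map proj₁ S)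
coclique-system {k = k} {L = L} {S} co = vertices-system (IsCoclique.unique co) nonadjacent′
  where
  nonadjacent′ : ∀ {u v} → u ∈ₗ S → v ∈ₗ S → u ≢ v → not (indicator L ∣ proj₁ u ∩ proj₁ v ∣) ≡ true
  nonadjacent′ {u} {v} u∈ v∈ u≢v with indicator L ∣ proj₁ u ∩ proj₁ v ∣ in eq
  ... | false = refl
  ... | true  = contradiction (u≢v , indicator⇒∈ℕ L eq) (IsCoclique.nonadjacent co u∈ v∈)

theorem1 : ∀ (k : ℕ) → 1 ≤ k →
    ∃[ n₀ ] (∀ (n : ℕ) → n₀ ≤ n →
    ∀ (L : Subset k) → Nonempty L → L ⊂ ⊤ →
    ∀ (α ω : ℕ) → IsIndependenceNumber (J n k L) α → IsCliqueNumber (J n k L) ω →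
    α * ω ≡ n C k →
    ∃[ t ] (L IsInitialSegment t ⊎ (∁ L) IsInitialSegment t))
theorem1 (suc m) _ = threshold (suc m) , main
  where
  main : ∀ n → threshold (suc m) ≤ n → ∀ (L : Subset (suc m)) → Nonempty L → L ⊂ ⊤ →
    ∀ α ω → IsIndependenceNumber (J n (suc m) L) α → IsCliqueNumber (J n (suc m) L) ω →
    α * ω ≡ n C suc m → ∃[ t ] (L IsInitialSegment t ⊎ (∁ L) IsInitialSegment t)
  main n n₀≤n L _ _ _ _ ((𝓘 , co , refl) , _) ((𝓒 , cl , refl) , _) αω≡ = result
    where
    AB≡ : length (map proj₁ 𝓘) * length (map proj₁ 𝓒) ≡ n C suc m
    AB≡ = trans (cong₂ _*_ (length-map proj₁ 𝓘) (length-map proj₁ 𝓒)) αω≡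
    result : ∃[ t ] (L IsInitialSegment t ⊎ (∁ L) IsInitialSegment t)
    -- The role of `X` goes to whichever of `L` and its complement contains `m`, that is, `k - 1`;
    -- its upward closure makes the other one initial.
    result with indicator L m in Xm
    ... | true with complement-initial (∁ L) (indicator L) (indicator-∁ L)
                      (λ { l (s≤s l<m) → no-gap n₀≤n (λ _ → refl) (clique-system cl) (coclique-system co)
                        (trans (*-comm (length (map proj₁ 𝓒)) (length (map proj₁ 𝓘))) AB≡) Xm l l<m })
    ...   | t , initial = t , inj₂ initial
    result | false with complement-initial L (not ∘ indicator L) (λ j _ → sym (not-involutive (indicator L j)))
                      (λ { l (s≤s l<m) → no-gap n₀≤n (λ j → sym (not-involutive (indicator L j))) (coclique-system co) (clique-system cl)
                        AB≡ (cong not Xm) l l<m })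
    ...   | t , initial = t , inj₁ initial
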